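{- There is a positive constant $c'$ such that the following holds. Let $T=(V,E)$ be a tree with $n$ vertices and let $S\subseteq V$ with $|S|=k\ge1$. If $S$ minimizes $IGL(T-S)$ among all subsets of $V$ of size $k$, then every connected component of $T-S$ has at most $c'(n/k)^5$ vertices.
   Context: For a graph $G=(V,E)$, $d_G(u,v)$ is the number of edges of a shortest $u$–$v$ path, or $\infty$ if none exists, with $1/\infty=0$; $IGL(G)=\sum_{\{u,v\}\subseteq V}\frac1{d_G(u,v)}$ over unordered pairs of distinct vertices. -}

module Defs where

open import Data.Bool using (Bool; true; false; _∧_; _∨_; not; if_then_else_)
open import Data.Nat using (ℕ; zero; suc; _<_; _≤_; _*_; _^_)
open import Data.Fin using (Fin; toℕ)
import Data.Fin as Fin
open import Data.Maybe using (Maybe; just; nothing)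
open import Data.Vec using (lookup)
open import Data.Fin.Subset using (Subset; _∉_; ∣_∣)
open import Data.Product using (Σ; _×_; ∃)
open import Data.Integer using (+_)
open import Data.Rational using (ℚ; 0ℚ; _+_; _/_)
open import Relation.Binary.PropositionalEquality using (_≡_)
open import Relation.Nullary using (¬_)
open import Function.Definitions using (Injective)

record Graph (n : ℕ) : Set where
  field
    adj   : Fin n → Fin n → Bool
    sym   : ∀ u v → adj u v ≡ adj v u
    irrefl : ∀ v → adj v v ≡ false
open Graph public

anyFin : ∀ {n} → (Fin n → Bool) → Bool
anyFin {zero}  f = false
anyFin {suc n} f = f Fin.zero ∨ anyFin (λ i → f (Fin.suc i))

sumFin : ∀ {n} → (Fin n → ℚ) → ℚ
sumFin {zero}  f = 0ℚ
sumFin {suc n} f = f Fin.zero + sumFin (λ i → f (Fin.suc i))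

_==_ : ∀ {n} → Fin n → Fin n → Bool
Fin.zero  == Fin.zero  = true
Fin.zero  == Fin.suc _ = false
Fin.suc _ == Fin.zero  = false
Fin.suc i == Fin.suc j = i == j

adjDel : ∀ {n} → Graph n → Subset n → Fin n → Fin n → Bool
adjDel G S u v = adj G u v ∧ not (lookup S u) ∧ not (lookup S v)

within : ∀ {n} → Graph n → Subset n → ℕ → Fin n → Fin n → Bool
within G S zero    u v = u == v
within G S (suc m) u v = within G S m u v ∨ anyFin (λ w → within G S m u w ∧ adjDel G S w v)

searchDist : ∀ {n} → Graph n → Subset n → Fin n → Fin n → ℕ → Maybe ℕ
searchDist G S u v zero = if within G S zero u v then just zero else nothing
searchDist G S u v (suc k) with searchDist G S u v k
... | just d  = just d
... | nothing = if within G S (suc k) u v then just (suc k) else nothing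

-- distance in G - S; nothing means ∞ (a shortest path has < n edges, so bound n suffices)
dist : ∀ {n} → Graph n → Subset n → Fin n → Fin n → Maybe ℕ
dist {n} G S u v = searchDist G S u v n

-- 1 / d with the convention 1/∞ = 0 (d = 0 never occurs for distinct vertices)
invDist : Maybe ℕ → ℚ
invDist nothing        = 0ℚ
invDist (just zero)    = 0ℚ
invDist (just (suc m)) = (+ 1) / suc m

IGLdel : ∀ {n} → Graph n → Subset n → ℚ
IGLdel G S = sumFin (λ u → sumFin (λ v →
  if lookup S u ∨ lookup S v then 0ℚ
  else (if Data.Nat._<ᵇ_ (toℕ u) (toℕ v) then invDist (dist G S u v) else 0ℚ)))
  where import Data.Nat

noVertices : ∀ {n} → Subset n
noVertices = Data.Fin.Subset.⊥
  where import Data.Fin.Subset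

Reach : ∀ {n} → Graph n → Subset n → Fin n → Fin n → Set
Reach G S u v = ∃ λ m → within G S m u v ≡ true

Connected : ∀ {n} → Graph n → Set
Connected G = ∀ u v → Reach G noVertices u v

record Cycle {n : ℕ} (G : Graph n) : Set where
  field
    len    : ℕ
    len≥3  : 3 ≤ len
    vtx    : Fin len → Fin n
    inj    : Injective _≡_ _≡_ vtx
    step   : ∀ (i j : Fin len) → suc (toℕ i) ≡ toℕ j → adj G (vtx i) (vtx j) ≡ true
    close  : ∀ (i j : Fin len) → suc (toℕ i) ≡ len → toℕ j ≡ 0 → adj G (vtx i) (vtx j) ≡ true

Acyclic : ∀ {n} → Graph n → Set
Acyclic G = ¬ Cycle G

IsTree : ∀ {n} → Graph n → Set
IsTree G = Connected G × Acyclic G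

-- (walks of length ≤ n suffice: any reachable vertex is at distance < n)
-- number of vertices of the component of T - S containing v
componentSize : ∀ {n} → Graph n → Subset n → Fin n → ℕ
componentSize {n} G S v = ∣ (Data.Vec.tabulate (λ w → not (lookup S w) ∧ within G S n v w)) ∣
  where import Data.Vec

{-# OPTIONS --safe #-}

-- Write d for the distance in T, and let P(u,v) be the set of x with
-- d(u,x) + d(x,v) = d(u,v), that is, the path from u to v.  Up to a factor 2,
-- IGL(T − S) sums 1/d(u,v) over the ordered pairs u ≠ v for which P(u,v) avoids S.
-- Fix a root r.  For s ∈ S let D(s) be the set of y for which s is the first
-- vertex of S on P(y,r).  These sets are disjoint, so some s has B = |D(s)| ≤ n/k.
-- Exchange s for some x ∉ S.  A pair that becomes connected has an end in D(s),
-- and if its other end v lies outside D(s) its weight is at most 1/d(v,s).  So the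
-- cost is at most B² + 2BR, with R the sum of 1/d(v,s) over those v.
-- If x is the neighbour p of s towards r, no pair with an end outside D(s) becomes
-- connected: the cost is at most B², while the pairs (p,v) gain at least R − 1.
-- By minimality R ≤ B² + 1, and hence every exchange costs O(B³).
-- Finally let x run through a component C of T − S with N vertices.  A pair u ≠ v
-- in C contributes 1/d(u,v) to the gain of each x on P(u,v), hence at least 1 in
-- total.  So the gains sum to at least N(N − 1), and N = O(B³) = O((n/k)³).

module Submission where

open import Defs hiding (sym)
open import Data.Nat hiding (_/_) renaming (_≟_ to _≟ℕ_)
open import Data.Nat.Properties hiding (_≟_)
open import Data.Nat.Divisibility using (∣-trans; m∣m*n; m≤n⇒m!∣n!)
open import Data.Nat.DivMod using (_/_; m*[n/m]≡n; /-monoʳ-≤; m/n≤m)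
open import Data.Nat.Tactic.RingSolver using (solve-∀)
open import Algebra.Properties.Semiring.Sum +-*-semiring
  using (sum; sum-syntax; ∑-distrib-+; ∑-comm; *-distribˡ-sum; *-distribʳ-sum; sum-cong-≗)
open import Data.Fin using (Fin; zero; suc; toℕ)
import Data.Fin.Properties as Fin
open import Data.Fin.Properties using (_≟_; any?; all?; toℕ-injective; toℕ≤pred[n])
open import Data.Fin.Subset using (Subset; _∈_; _∉_; ∣_∣; inside; outside; ⁅_⁆; _⊆_)
open import Data.Fin.Subset.Properties using (_∈?_; ∣p∣≤n; x∈⁅x⁆; x∈⁅y⁆⇒x≡y; ∉⊥)
import Data.Bool as Bool
open import Data.Bool using (Bool; true; false; _∧_; _∨_; not; if_then_else_)
open import Data.Bool.Properties using (∧-conicalˡ; ∧-conicalʳ; ∨-zeroʳ; ∨-conicalˡ; ¬-not)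
open import Data.Vec using ([]; _∷_; _[_]≔_; here; there; lookup; tabulate)
open import Data.Vec.Properties using ([]≔-updates; []≔-minimal; []=⇒lookup; lookup⇒[]=; lookup∘tabulate)
open import Data.Maybe using (just; nothing)
open import Data.Product using (Σ; ∃; _×_; _,_; proj₁; proj₂)
open import Data.Sum using (_⊎_; inj₁; inj₂)
import Data.Integer as ℤ
import Data.Integer.Properties as ℤ
open import Data.Rational using (ℚ; 0ℚ; fromℚᵘ; toℚᵘ)
import Data.Rational as ℚ
import Data.Rational.Properties as ℚ
import Data.Rational.Unnormalised as ℚᵘ
import Data.Rational.Unnormalised.Properties as ℚᵘ
open import Function using (_∘_)
open import Relation.Nullary using (Dec; yes; no; ¬_; contradiction)
open import Relation.Nullary.Decidable using (_×-dec_; _→-dec_; ¬?)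
open import Relation.Unary using (Decidable)
open import Relation.Binary.PropositionalEquality

-- Finite sums and indicators

private variable
  n : ℕ
  P Q : Set

χ : Dec P → ℕ
χ (yes _) = 1
χ (no _)  = 0

χ-yes : (a? : Dec P) → P → χ a? ≡ 1
χ-yes (yes _) a = refl
χ-yes (no ¬a) a = contradiction a ¬a

χ-yes-* : (a? : Dec P) → P → ∀ m → χ a? * m ≡ m
χ-yes-* a? a m = trans (cong (_* m) (χ-yes a? a)) (*-identityˡ m)

χ-no : (a? : Dec P) → ¬ P → χ a? ≡ 0
χ-no (yes a) ¬a = contradiction a ¬a
χ-no (no _)  ¬a = refl

χ≤1 : (a? : Dec P) → χ a? ≤ 1
χ≤1 (yes _) = ≤-refl
χ≤1 (no _)  = z≤n

χ-mono : (a? : Dec P) (b? : Dec Q) → (P → Q) → χ a? ≤ χ b?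
χ-mono (no _)  b?      f = z≤n
χ-mono (yes a) b? f = ≤-reflexive (sym (χ-yes b? (f a)))

χ-× : (a? : Dec P) (b? : Dec Q) → χ (a? ×-dec b?) ≡ χ a? * χ b?
χ-× (yes _) (yes _) = refl
χ-× (yes _) (no _)  = refl
χ-× (no _)  _       = refl

sum-mono : {f g : Fin n → ℕ} → (∀ i → f i ≤ g i) → sum f ≤ sum g
sum-mono {zero}  f≤g = z≤n
sum-mono {suc n} f≤g = +-mono-≤ (f≤g zero) (sum-mono (f≤g ∘ suc))

term≤sum : (f : Fin n → ℕ) (i : Fin n) → f i ≤ sum f
term≤sum f zero    = m≤m+n _ _
term≤sum f (suc i) = ≤-trans (term≤sum (f ∘ suc) i) (m≤n+m _ _)

sum-zero : {f : Fin n → ℕ} → (∀ i → f i ≡ 0) → sum f ≡ 0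
sum-zero {zero}  f≡0 = refl
sum-zero {suc n} f≡0 = cong₂ _+_ (f≡0 zero) (sum-zero (f≡0 ∘ suc))

sum≤n : {f : Fin n → ℕ} → (∀ i → f i ≤ 1) → sum f ≤ n
sum≤n {zero}  f≤1 = z≤n
sum≤n {suc n} f≤1 = +-mono-≤ (f≤1 zero) (sum≤n (f≤1 ∘ suc))

sum-χ≤1 : {P : Fin n → Set} (P? : Decidable P) →
          (∀ {i j} → P i → P j → i ≡ j) → sum (λ i → χ (P? i)) ≤ 1
sum-χ≤1 {zero}  P? uniq = z≤n
sum-χ≤1 {suc n} P? uniq with P? zero
... | no _  = sum-χ≤1 (P? ∘ suc) (λ p q → Fin.suc-injective (uniq p q))
... | yes p = s≤s (≤-reflexive (sum-zero λ i → χ-no (P? (suc i)) λ q → Fin.0≢1+n (uniq p q)))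

sum-δ : (i : Fin n) → sum (λ j → χ (i ≟ j)) ≡ 1
sum-δ i = ≤-antisym (sum-χ≤1 (i ≟_) (λ { refl refl → refl }))
  (subst (_≤ sum (λ j → χ (i ≟ j))) (χ-yes (i ≟ i) refl) (term≤sum (λ j → χ (i ≟ j)) i))

sum-δ-* : (i : Fin n) (m : ℕ) → sum (λ j → χ (i ≟ j) * m) ≡ m
sum-δ-* i m = trans (sym (*-distribʳ-sum m (λ j → χ (i ≟ j))))
  (trans (cong (_* m) (sum-δ i)) (*-identityˡ m))

∑∑ : (Fin n → Fin n → ℕ) → ℕ
∑∑ {n} f = ∑[ u < n ] ∑[ v < n ] f u v

∑∑-mono : {f g : Fin n → Fin n → ℕ} → (∀ u v → f u v ≤ g u v) → ∑∑ f ≤ ∑∑ g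
∑∑-mono f≤g = sum-mono λ u → sum-mono (f≤g u)

∑∑-cong : {f g : Fin n → Fin n → ℕ} → (∀ u v → f u v ≡ g u v) → ∑∑ f ≡ ∑∑ g
∑∑-cong f≡g = sum-cong-≗ λ u → sum-cong-≗ (f≡g u)

∑∑-+ : (f g : Fin n → Fin n → ℕ) → ∑∑ (λ u v → f u v + g u v) ≡ ∑∑ f + ∑∑ g
∑∑-+ f g = trans (sum-cong-≗ λ u → ∑-distrib-+ (f u) (g u)) (∑-distrib-+ (λ u → sum (f u)) (λ u → sum (g u)))

∑∑-* : (f g : Fin n → ℕ) → ∑∑ (λ u v → f u * g v) ≡ sum f * sum g
∑∑-* f g = trans (sum-cong-≗ λ u → sym (*-distribˡ-sum (f u) g)) (sym (*-distribʳ-sum (sum g) f))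

-- Cardinality of subsets and exchange of one element

∣p∣≡sum : (p : Subset n) → ∣ p ∣ ≡ sum (λ i → χ (i ∈? p))
∣p∣≡sum [] = refl
∣p∣≡sum (true ∷ p) = cong suc (trans (∣p∣≡sum p) (sum-cong-≗ λ i → lem i))
  where
  lem : ∀ i → χ (i ∈? p) ≡ χ (suc i ∈? (true ∷ p))
  lem i with i ∈? p
  ... | yes _ = refl
  ... | no _ = refl
∣p∣≡sum (false ∷ p) = trans (∣p∣≡sum p) (sum-cong-≗ λ i → lem i)
  where
  lem : ∀ i → χ (i ∈? p) ≡ χ (suc i ∈? (false ∷ p))
  lem i with i ∈? p
  ... | yes _ = refl
  ... | no _ = refl

-- Insertion comes last, so x belongs to the result even if x = s.
swap : Subset n → Fin n → Fin n → Subset n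
swap S s x = (S [ s ]≔ outside) [ x ]≔ inside

∣remove∣ : ∀ {S : Subset n} {s} → s ∈ S → suc ∣ S [ s ]≔ outside ∣ ≡ ∣ S ∣
∣remove∣ here = refl
∣remove∣ (there {y = false} s∈S) = ∣remove∣ s∈S
∣remove∣ (there {y = true}  s∈S) = cong suc (∣remove∣ s∈S)

∣insert∣ : ∀ (S : Subset n) x → x ∉ S → ∣ S [ x ]≔ inside ∣ ≡ suc ∣ S ∣
∣insert∣ (true  ∷ S) zero    x∉S = contradiction here x∉S
∣insert∣ (false ∷ S) zero    x∉S = refl
∣insert∣ (true  ∷ S) (suc x) x∉S = cong suc (∣insert∣ S x (x∉S ∘ there))
∣insert∣ (false ∷ S) (suc x) x∉S = ∣insert∣ S x (x∉S ∘ there)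

∈-remove⁻ : ∀ {S : Subset n} s {x} → x ∈ S [ s ]≔ outside → x ∈ S
∈-remove⁻ {S = _ ∷ _} zero    (there x∈) = there x∈
∈-remove⁻ {S = _ ∷ _} (suc s) here       = here
∈-remove⁻ {S = _ ∷ _} (suc s) (there x∈) = there (∈-remove⁻ s x∈)

∣swap∣ : ∀ (S : Subset n) {s x} → s ∈ S → x ∉ S → ∣ swap S s x ∣ ≡ ∣ S ∣
∣swap∣ S {s} {x} s∈S x∉S = trans (∣insert∣ _ x (x∉S ∘ ∈-remove⁻ s)) (∣remove∣ s∈S)

x∈swap : ∀ (S : Subset n) s x → x ∈ swap S s x
x∈swap S s x = []≔-updates _ x

∈-swap : ∀ (S : Subset n) s x {y} → y ∈ S → y ≢ s → y ∈ swap S s x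
∈-swap S s x {y} y∈S y≢s with y ≟ x
... | yes refl = x∈swap S s x
... | no y≢x   = []≔-minimal _ y x y≢x ([]≔-minimal S y s y≢s y∈S)

-- Scaling by n ! makes the reciprocals of all distances ≤ n natural numbers.
ω : ℕ → ℕ → ℕ
ω n zero    = 0
ω n (suc m) = n ! / suc m

ω≤n! : ∀ n m → ω n m ≤ n !
ω≤n! n zero    = z≤n
ω≤n! n (suc m) = m/n≤m (n !) (suc m)

-- The hypothesis `1 ≤ a` excludes the default `ω n 0 = 0`, at which monotonicity fails.
ω-anti : ∀ n {a b} → 1 ≤ a → a ≤ b → ω n b ≤ ω n a
ω-anti n {suc a} {suc b} _ a≤b = /-monoʳ-≤ (n !) a≤b

*-ω : ∀ n {m} → 1 ≤ m → m ≤ n → m * ω n m ≡ n !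
*-ω n {suc m} _ m≤n = m*[n/m]≡n (∣-trans (m∣m*n (m !)) (m≤n⇒m!∣n! m≤n))

-- The exchange argument

record Metric (n : ℕ) : Set where
  field
    d      : Fin n → Fin n → ℕ
    d-refl : ∀ u → d u u ≡ 0
    d-zero : ∀ {u v} → d u v ≡ 0 → u ≡ v
    d-sym  : ∀ u v → d u v ≡ d v u
    d-tri  : ∀ u x v → d u v ≤ d u x + d x v

  On : Fin n → Fin n → Fin n → Set
  On x u v = d u x + d x v ≡ d u v

  abstract
    on? : ∀ x u v → Dec (On x u v)
    on? x u v = d u x + d x v ≟ℕ d u v

  on-sym : ∀ {x u v} → On x u v → On x v u
  on-sym {x} {u} {v} p = begin
    d v x + d x u ≡⟨ +-comm (d v x) _ ⟩
    d x u + d v x ≡⟨ cong₂ _+_ (d-sym x u) (d-sym v x) ⟩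
    d u x + d x v ≡⟨ p ⟩
    d u v         ≡⟨ d-sym u v ⟩
    d v u         ∎
    where open ≡-Reasoning

  on-left : ∀ u v → On u u v
  on-left u v = cong (_+ d u v) (d-refl u)

  on-right : ∀ u v → On v u v
  on-right u v = trans (cong (d u v +_) (d-refl v)) (+-identityʳ _)

  on-self : ∀ {x u} → On x u u → x ≡ u
  on-self {x} {u} p = sym (d-zero (m+n≡0⇒m≡0 (d u x) (trans p (d-refl u))))

  -- The route u, x, s, v has length d(u,s) + d(s,v) = d(u,v), and leaving out s cannot make it
  -- longer.
  on-extend : ∀ {s x u v} → On s u v → On x u s → On x u v
  on-extend {s} {x} {u} {v} p q = ≤-antisym (begin
    d u x + d x v           ≤⟨ +-monoʳ-≤ (d u x) (d-tri x s v) ⟩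
    d u x + (d x s + d s v) ≡⟨ +-assoc (d u x) _ _ ⟨
    d u x + d x s + d s v   ≡⟨ cong (_+ d s v) q ⟩
    d u s + d s v           ≡⟨ p ⟩
    d u v ∎) (d-tri u x v)
    where open ≤-Reasoning

  -- Substituting one equation into the other and cancelling d(s,r) leaves d(s,t) + d(t,s) = 0.
  on-antisym : ∀ {s t r} → On t s r → On s t r → s ≡ t
  on-antisym {s} {t} {r} p q = d-zero (m+n≡0⇒m≡0 (d s t) {d t s}
    (+-cancelʳ-≡ (d s r) _ 0 (begin
      d s t + d t s + d s r   ≡⟨ +-assoc (d s t) _ _ ⟩
      d s t + (d t s + d s r) ≡⟨ cong (d s t +_) q ⟩
      d s t + d t r           ≡⟨ p ⟩
      d s r                   ∎)))
    where open ≡-Reasoning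

  -- In a tree this says that u and v lie in the same component of T − S.
  Avoids : Subset n → Fin n → Fin n → Set
  Avoids S u v = ∀ x → x ∈ S → ¬ On x u v

  abstract
    avoids? : ∀ S u v → Dec (Avoids S u v)
    avoids? S u v = all? λ x → (x ∈? S) →-dec ¬? (on? x u v)

  avoids-sym : ∀ {S u v} → Avoids S u v → Avoids S v u
  avoids-sym av x x∈S = av x x∈S ∘ on-sym

  ωd : Fin n → Fin n → ℕ
  ωd u v = ω n (d u v)

  kept : Subset n → Fin n → Fin n → ℕ
  kept S u v = χ (avoids? S u v) * ωd u v

  -- Each pair of vertices is counted twice: this is 2 n ! IGL(T − S).
  energy : Subset n → ℕ
  energy S = ∑∑ (kept S)

-- The facts about trees on which the exchange argument rests: the path u-v runs inside the union of
-- the paths u-w and w-v, an edge splits the vertices into its two sides, every path between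
-- distinct vertices has a first step, and a path has at least one more vertex than edges.
record TreeMetric (n : ℕ) : Set where
  field
    metric : Metric n
  open Metric metric public
  field
    on-split : ∀ {x u v} w → On x u v → On x u w ⊎ On x w v
    on-edge  : ∀ {s p} v → d s p ≡ 1 → On s p v ⊎ On p s v
    toward   : ∀ {s r} → s ≢ r → ∃ λ p → d s p ≡ 1 × On p s r
    on-count : ∀ u v → suc (d u v) ≤ sum (λ x → χ (on? x u v))

  d-pos : ∀ {u v} → u ≢ v → 1 ≤ d u v
  d-pos {u} {v} u≢v with d u v in eq
  ... | zero  = contradiction (d-zero eq) u≢v
  ... | suc _ = s≤s z≤n

  -- By `on-count` at least d(u,v) + 1 of the n vertices lie on the path, so d(u,v) ≤ n and d(u,v)
  -- divides n !.
  *-ωd : ∀ {u v} → u ≢ v → d u v * ωd u v ≡ n !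
  *-ωd {u} {v} u≢v = *-ω n (d-pos u≢v)
    (≤-trans (n≤1+n _) (≤-trans (on-count u v) (sum≤n λ x → χ≤1 (on? x u v))))

module Exchange {n} (T : TreeMetric n) (S : Subset n) where
  open TreeMetric T

  M : ℕ
  M = n !

  -- With S and x ∉ S these are the pairs that deleting x cuts; with the swapped set and s ∈ S, the
  -- pairs that restoring s reconnects. The diagonal has weight 0 because `ω n 0 = 0`.
  through : Subset n → Fin n → Fin n → Fin n → ℕ
  through S′ x u v = χ (avoids? S′ u v ×-dec on? x u v) * ωd u v

  gain : Fin n → ℕ
  gain x = ∑∑ (through S x)

  cost : Fin n → Fin n → ℕ
  cost s x = ∑∑ (through (swap S s x) s)

  -- A pair that survives the swap has no x on its path, so the left side is at most 1. If S
  -- separated that pair, then s must be on its path, since every other vertex of S stays in the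
  -- swapped set.
  swap-pointwise : ∀ s x u v →
    χ (avoids? (swap S s x) u v) + χ (avoids? S u v ×-dec on? x u v) ≤
    χ (avoids? S u v) + χ (avoids? (swap S s x) u v ×-dec on? s u v)
  swap-pointwise s x u v
    with avoids? (swap S s x) u v | avoids? S u v | on? x u v | on? s u v
  ... | yes av | _       | yes on | _     = contradiction on (av x (x∈swap S s x))
  ... | yes av | yes _   | no _  | _      = s≤s z≤n
  ... | yes av | no _    | no _  | yes _  = ≤-refl
  ... | yes av | no ¬av  | no _  | no ¬on = contradiction av′ ¬av
    where
    av′ : Avoids S u v
    av′ y y∈S with y ≟ s
    ... | yes refl = ¬on
    ... | no y≢s   = av y (∈-swap S s x y∈S y≢s)
  ... | no _   | yes _   | yes _ | _      = s≤s z≤n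
  ... | no _   | yes _   | no _  | _      = z≤n
  ... | no _   | no _    | _     | _      = z≤n

  swap-energy : ∀ s x → energy (swap S s x) + gain x ≤ energy S + cost s x
  swap-energy s x = begin
    energy S′ + gain x                         ≡⟨ ∑∑-+ (kept S′) (through S x) ⟨
    (∑∑ λ u v → kept S′ u v + through S x u v) ≤⟨ ∑∑-mono pointwise ⟩
    (∑∑ λ u v → kept S u v + through S′ s u v) ≡⟨ ∑∑-+ (kept S) (through S′ s) ⟩
    energy S + cost s x                        ∎
    where
    open ≤-Reasoning
    S′ = swap S s x
    pointwise : ∀ u v → kept S′ u v + through S x u v ≤ kept S u v + through S′ s u v
    pointwise u v = subst₂ _≤_
      (*-distribʳ-+ (ωd u v) (χ (avoids? S′ u v)) (χ (avoids? S u v ×-dec on? x u v)))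
      (*-distribʳ-+ (ωd u v) (χ (avoids? S u v)) (χ (avoids? S′ u v ×-dec on? s u v)))
      (*-monoˡ-≤ (ωd u v) (swap-pointwise s x u v))

  -- For s ∈ S: y is s itself or lies in a component of T − S adjacent to s.
  Near : Fin n → Fin n → Set
  Near s y = ∀ x → x ∈ S → On x y s → x ≡ s

  abstract
    near? : ∀ s y → Dec (Near s y)
    near? s y = all? λ x → (x ∈? S) →-dec (on? x y s →-dec (x ≟ s))

  module _ (r : Fin n) where

    -- Seen from y ∈ Below s, the first vertex of S on the way to r is s, so the
    -- sets Below s are disjoint.
    Below Above : Fin n → Fin n → Set
    Below s y = Near s y × On s y r
    Above s y = Near s y × ¬ On s y r

    abstract
      below? : ∀ s y → Dec (Below s y)
      below? s y = near? s y ×-dec on? s y r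

      above? : ∀ s y → Dec (Above s y)
      above? s y = near? s y ×-dec ¬? (on? s y r)

    -- In the notation of the sketch, `size s` is B and `reach s` is R multiplied by n !.
    size : Fin n → ℕ
    size s = sum λ y → χ (below? s y)

    reach : Fin n → ℕ
    reach s = sum λ y → χ (above? s y) * ωd y s

    below-self : ∀ s → Below s s
    below-self s = (λ _ _ → on-self) , on-left s r

    1≤size : ∀ s → 1 ≤ size s
    1≤size s = subst (_≤ size s) (χ-yes (below? s s) (below-self s)) (term≤sum (λ y → χ (below? s y)) s)

    -- If s ≠ t, nearness to t keeps s off the path y-t, so splitting y-r at t puts s between t and
    -- r. By symmetry t is between s and r, which forces s = t.
    below-unique : ∀ {y s t} → s ∈ S × Below s y → t ∈ S × Below t y → s ≡ t
    below-unique {y} {s} {t} (s∈S , near-s , on-s) (t∈S , near-t , on-t) with s ≟ t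
    ... | yes s≡t = s≡t
    ... | no s≢t  = on-antisym t-on s-on
      where
      s-on : On s t r
      s-on with on-split t on-s
      ... | inj₁ q = contradiction (near-t s s∈S q) s≢t
      ... | inj₂ q = q
      t-on : On t s r
      t-on with on-split s on-t
      ... | inj₁ q = contradiction (sym (near-s t t∈S q)) s≢t
      ... | inj₂ q = q

    -- Double counting: after exchanging the sums, each y is counted for at most one s.
    sum-size≤n : sum (λ s → χ (s ∈? S) * size s) ≤ n
    sum-size≤n = begin
      sum (λ s → χ (s ∈? S) * size s)
        ≡⟨ sum-cong-≗ (λ s → *-distribˡ-sum (χ (s ∈? S)) (λ y → χ (below? s y))) ⟩
      (∑∑ λ s y → χ (s ∈? S) * χ (below? s y))
        ≡⟨ ∑-comm (λ s y → χ (s ∈? S) * χ (below? s y)) ⟩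
      (∑∑ λ y s → χ (s ∈? S) * χ (below? s y))
        ≡⟨ ∑∑-cong (λ y s → sym (χ-× (s ∈? S) (below? s y))) ⟩
      (∑∑ λ y s → χ ((s ∈? S) ×-dec below? s y))
        ≤⟨ sum≤n (λ y → sum-χ≤1 (λ s → (s ∈? S) ×-dec below? s y) below-unique) ⟩
      n ∎
      where open ≤-Reasoning

    -- Averaging without division: if every s ∈ S had k · `size s` ≥ n + 1, summation over S would
    -- give k(n + 1) ≤ kn.
    small-size : 1 ≤ ∣ S ∣ → ∃ λ s → s ∈ S × ∣ S ∣ * size s ≤ n
    small-size 1≤k with any? (λ s → (s ∈? S) ×-dec (∣ S ∣ * size s ≤? n))
    ... | yes found = found
    ... | no ¬found = contradiction too-big (<⇒≱ (*-monoʳ-< ∣ S ∣ (n<1+n n)))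
      where
      instance _ = >-nonZero 1≤k
      open ≤-Reasoning
      pointwise : ∀ s → χ (s ∈? S) * suc n ≤ χ (s ∈? S) * (∣ S ∣ * size s)
      pointwise s with s ∈? S
      ... | no _    = z≤n
      ... | yes s∈S = *-monoʳ-≤ 1 (≰⇒> λ le → ¬found (s , s∈S , le))
      too-big : ∣ S ∣ * suc n ≤ ∣ S ∣ * n
      too-big = begin
        ∣ S ∣ * suc n                                    ≡⟨ cong (_* suc n) (∣p∣≡sum S) ⟩
        sum (λ s → χ (s ∈? S)) * suc n                   ≡⟨ *-distribʳ-sum (suc n) (λ s → χ (s ∈? S)) ⟩
        sum (λ s → χ (s ∈? S) * suc n)                   ≤⟨ sum-mono pointwise ⟩
        sum (λ s → χ (s ∈? S) * (∣ S ∣ * size s))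
          ≡⟨ sum-cong-≗ (λ s → x*[k*y] (χ (s ∈? S)) ∣ S ∣ (size s)) ⟩
        sum (λ s → ∣ S ∣ * (χ (s ∈? S) * size s))        ≡⟨ *-distribˡ-sum ∣ S ∣ (λ s → χ (s ∈? S) * size s) ⟨
        ∣ S ∣ * sum (λ s → χ (s ∈? S) * size s)          ≤⟨ *-monoʳ-≤ ∣ S ∣ sum-size≤n ⟩
        ∣ S ∣ * n                                        ∎
        where
        x*[k*y] : ∀ x k y → x * (k * y) ≡ k * (x * y)
        x*[k*y] = solve-∀

    -- Another vertex of S between u and s would also be between u and v, and the swap does not
    -- remove it.
    new-near : ∀ {s x u v} → Avoids (swap S s x) u v → On s u v → Near s u
    new-near {s} {x} av on y y∈S q with y ≟ s
    ... | yes y≡s = y≡s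
    ... | no y≢s  = contradiction (on-extend on q) (av y (∈-swap S s x y∈S y≢s))

    above-pos : ∀ {s y} → Above s y → 1 ≤ d y s
    above-pos (_ , ¬on) = d-pos λ { refl → ¬on (on-left _ r) }

    -- As s is on the path, d(u,v) ≥ d(v,s); `above-pos` keeps the smaller distance positive, as
    -- `ω-anti` requires.
    ωd-farther : ∀ {s u v} → Above s v → On s u v → ωd u v ≤ ωd v s
    ωd-farther {s} {u} {v} ab on = ω-anti n (above-pos ab)
      (subst (_≤ d u v) (d-sym s v) (subst (d s v ≤_) on (m≤n+m (d s v) (d u s))))

    both down up : Fin n → Fin n → Fin n → ℕ
    both s u v = χ (below? s u) * (χ (below? s v) * M)
    down s u v = χ (below? s u) * (χ (above? s v) * ωd v s)
    up   s u v = (χ (above? s u) * ωd u s) * χ (below? s v)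

    through≤ : ∀ s x u v → through (swap S s x) s u v ≤ both s u v + down s u v + up s u v
    through≤ s x u v with avoids? (swap S s x) u v ×-dec on? s u v
    ... | no _ = z≤n
    ... | yes (av , on) = ≤-trans (≤-reflexive (*-identityˡ (ωd u v))) (go (on? s u r) (on? s v r))
      where
      nu = new-near {s} {x} av on
      nv = new-near {s} {x} (avoids-sym av) (on-sym on)
      open ≤-Reasoning
      go : Dec (On s u r) → Dec (On s v r) → ωd u v ≤ both s u v + down s u v + up s u v
      go (yes pu) (yes pv) = begin
        ωd u v                               ≤⟨ ω≤n! n (d u v) ⟩
        M                                    ≡⟨ χ-yes-* (below? s v) (nv , pv) M ⟨
        χ (below? s v) * M                   ≡⟨ χ-yes-* (below? s u) (nu , pu) _ ⟨
        both s u v                           ≤⟨ m≤m+n _ (down s u v) ⟩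
        both s u v + down s u v              ≤⟨ m≤m+n _ (up s u v) ⟩
        both s u v + down s u v + up s u v   ∎
      go (yes pu) (no ¬pv) = begin
        ωd u v                               ≤⟨ ωd-farther (nv , ¬pv) on ⟩
        ωd v s                               ≡⟨ χ-yes-* (above? s v) (nv , ¬pv) _ ⟨
        χ (above? s v) * ωd v s              ≡⟨ χ-yes-* (below? s u) (nu , pu) _ ⟨
        down s u v                           ≤⟨ m≤n+m _ (both s u v) ⟩
        both s u v + down s u v              ≤⟨ m≤m+n _ (up s u v) ⟩
        both s u v + down s u v + up s u v   ∎
      go (no ¬pu) (yes pv) = begin
        ωd u v                               ≡⟨ cong (ω n) (d-sym u v) ⟩
        ωd v u                               ≤⟨ ωd-farther (nu , ¬pu) (on-sym on) ⟩
        ωd u s                               ≡⟨ χ-yes-* (above? s u) (nu , ¬pu) _ ⟨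
        χ (above? s u) * ωd u s              ≡⟨ *-identityʳ _ ⟨
        χ (above? s u) * ωd u s * 1          ≡⟨ cong (χ (above? s u) * ωd u s *_) (χ-yes (below? s v) (nv , pv)) ⟨
        up s u v                             ≤⟨ m≤n+m _ (both s u v + down s u v) ⟩
        both s u v + down s u v + up s u v   ∎
      -- Since s is on the path u-v, it is on u-r or on r-v, so at least one end is below s.
      go (no ¬pu) (no ¬pv) with on-split r on
      ... | inj₁ q = contradiction q ¬pu
      ... | inj₂ q = contradiction (on-sym q) ¬pv

    ∑∑-both : ∀ s → ∑∑ (both s) ≡ size s * (size s * M)
    ∑∑-both s = trans (∑∑-* (λ u → χ (below? s u)) (λ v → χ (below? s v) * M))
      (cong (size s *_) (sym (*-distribʳ-sum M (λ v → χ (below? s v)))))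

    cost≤ : ∀ s x → cost s x ≤ size s * (size s * M) + size s * reach s + reach s * size s
    cost≤ s x = begin
      cost s x
        ≤⟨ ∑∑-mono (through≤ s x) ⟩
      (∑∑ λ u v → both s u v + down s u v + up s u v)
        ≡⟨ ∑∑-+ (λ u v → both s u v + down s u v) (up s) ⟩
      (∑∑ λ u v → both s u v + down s u v) + ∑∑ (up s)
        ≡⟨ cong (_+ ∑∑ (up s)) (∑∑-+ (both s) (down s)) ⟩
      ∑∑ (both s) + ∑∑ (down s) + ∑∑ (up s)
        ≡⟨ cong₂ _+_ (cong₂ _+_ (∑∑-both s)
             (∑∑-* (λ u → χ (below? s u)) (λ v → χ (above? s v) * ωd v s)))
             (∑∑-* (λ u → χ (above? s u) * ωd u s) (λ v → χ (below? s v))) ⟩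
      size s * (size s * M) + size s * reach s + reach s * size s ∎
      where open ≤-Reasoning

    module _ {s p} (s∈S : s ∈ S) (sp : d s p ≡ 1) (on-p : On p s r) where

      -- Otherwise y is on the side of s of the edge sp, so s lies between p and y. Splitting at r,
      -- either s is between p and r, though p is the step from s towards r, or s is between r and
      -- y, though y is not below s.
      above-through : ∀ {y} → Above s y → On p y s
      above-through {y} (near , ¬on) with on-edge y sp
      ... | inj₂ q = on-sym q
      ... | inj₁ q with on-split r q
      ...   | inj₂ q′ = contradiction (on-sym q′) ¬on
      ...   | inj₁ q′ with on-antisym on-p q′
      ...     | refl = contradiction (trans (sym sp) (d-refl s)) λ ()

      through-neighbour≤ : ∀ u v → through (swap S s p) s u v ≤ both s u v
      through-neighbour≤ u v with avoids? (swap S s p) u v ×-dec on? s u v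
      ... | no _ = z≤n
      ... | yes (av , on) = ≤-trans (≤-reflexive (*-identityˡ (ωd u v))) (go (on? s u r) (on? s v r))
        where
        nu = new-near {s} {p} av on
        nv = new-near {s} {p} (avoids-sym av) (on-sym on)
        open ≤-Reasoning
        go : Dec (On s u r) → Dec (On s v r) → ωd u v ≤ both s u v
        go (yes pu) (yes pv) = begin
          ωd u v              ≤⟨ ω≤n! n (d u v) ⟩
          M                   ≡⟨ χ-yes-* (below? s v) (nv , pv) M ⟨
          χ (below? s v) * M  ≡⟨ χ-yes-* (below? s u) (nu , pu) _ ⟨
          both s u v          ∎
        -- A path from an end above s to s passes p, which is deleted after the swap; so only pairs
        -- with both ends below s reconnect.
        go (no ¬pu) _ = contradiction (on-extend on (above-through (nu , ¬pu)))
                          (av p (x∈swap S s p))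
        go _ (no ¬pv) = contradiction (on-sym (on-extend (on-sym on) (above-through (nv , ¬pv))))
                          (av p (x∈swap S s p))

      cost-neighbour≤ : cost s p ≤ size s * (size s * M)
      cost-neighbour≤ = ≤-trans (∑∑-mono through-neighbour≤) (≤-reflexive (∑∑-both s))

      -- A vertex v above s is connected to p in T - S and is closer to p than to s, so the pair
      -- (p,v) in the gain of p pays for v. The exception is v = p, where the pair has weight 0; the
      -- extra M covers it.
      neighbour-pointwise : ∀ v → χ (above? s v) * ωd v s ≤ through S p p v + χ (p ≟ v) * M
      neighbour-pointwise v with above? s v
      ... | no _ = z≤n
      ... | yes ab = ≤-trans (≤-reflexive (*-identityˡ _)) (go (p ≟ v))
        where
        open ≤-Reasoning
        on = above-through ab
        go : (p≟v : Dec (p ≡ v)) → ωd v s ≤ through S p p v + χ p≟v * M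
        go (yes _) = begin
          ωd v s                   ≤⟨ ω≤n! n (d v s) ⟩
          M                        ≡⟨ *-identityˡ M ⟨
          1 * M                    ≤⟨ m≤n+m _ (through S p p v) ⟩
          through S p p v + 1 * M  ∎
        go (no p≢v) = begin
          ωd v s                   ≤⟨ ω-anti n (d-pos p≢v) dp≤ ⟩
          ωd p v                   ≡⟨ χ-yes-* (avoids? S p v ×-dec on? p p v) (av , on-left p v) _ ⟨
          through S p p v          ≤⟨ m≤m+n _ _ ⟩
          through S p p v + 0 * M  ∎
          where
          dp≤ : d p v ≤ d v s
          dp≤ = subst₂ _≤_ (d-sym v p) on (m≤m+n _ _)
          s∉ : ¬ On s v p
          s∉ q = contradiction (on-antisym (on-sym on) (on-sym q)) λ { refl → contradiction (trans (sym sp) (d-refl s)) λ () }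
          av : Avoids S p v
          av y y∈S q with proj₁ ab y y∈S (on-extend on (on-sym q))
          ... | refl = s∉ (on-sym q)

      reach≤ : reach s ≤ gain p + M
      reach≤ = begin
        reach s
          ≤⟨ sum-mono neighbour-pointwise ⟩
        (∑[ v < n ] (through S p p v + χ (p ≟ v) * M))
          ≡⟨ ∑-distrib-+ (through S p p) (λ v → χ (p ≟ v) * M) ⟩
        sum (through S p p) + sum (λ v → χ (p ≟ v) * M)
          -- Of the double sum `gain p` only the row u = p is used.
          ≤⟨ +-mono-≤ (term≤sum (λ u → sum (through S p u)) p) (≤-reflexive (sum-δ-* p M)) ⟩
        gain p + M ∎
        where
        open ≤-Reasoning

    reach≡0 : ∀ {s} → (∀ y → ¬ Above s y) → reach s ≡ 0
    reach≡0 {s} none = sum-zero λ y → cong (_* ωd y s) (χ-no (above? s y) (none y))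

  -- Averaging the gain over a component

  component : Fin n → ℕ
  component c = sum λ x → χ (avoids? S c x)

  -- Each x on the path u-v lies in the component and collects n ! / d(u,v), which adds up to at
  -- least n !. A diagonal pair collects nothing, hence the correction term.
  average-pointwise : ∀ c u v → χ (avoids? S c u) * (χ (avoids? S c v) * M) ≤
    sum (λ x → χ (avoids? S c x) * through S x u v) + χ (avoids? S c u) * (χ (u ≟ v) * M)
  average-pointwise c u v with avoids? S c u
  ... | no _   = z≤n
  ... | yes cu with avoids? S c v
  ...   | no _   = z≤n
  ...   | yes cv = ≤-trans (≤-reflexive (trans (*-identityˡ _) (*-identityˡ M))) (go (u ≟ v))
    where
    open ≤-Reasoning
    total = sum λ x → χ (avoids? S c x) * through S x u v
    av : Avoids S u v
    -- The path u-v runs inside the union of the paths c-u and c-v, both free of S.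
    av y y∈S on with on-split c on
    ... | inj₁ q = cu y y∈S (on-sym q)
    ... | inj₂ q = cv y y∈S q
    inside-component : ∀ {x} → On x u v → Avoids S c x
    inside-component on y y∈S q with on-split u q
    ... | inj₁ q′ = cu y y∈S q′
    ... | inj₂ q′ = av y y∈S (on-extend on q′)
    term : ∀ x → χ (on? x u v) * ωd u v ≤ χ (avoids? S c x) * through S x u v
    term x with on? x u v
    ... | no _   = z≤n
    ... | yes on = begin
      1 * ωd u v                                 ≡⟨ cong (_* ωd u v) (χ-yes (avoids? S u v ×-dec yes on) (av , on)) ⟨
      χ (avoids? S u v ×-dec yes on) * ωd u v    ≡⟨ χ-yes-* (avoids? S c x) (inside-component on) _ ⟨
      χ (avoids? S c x) * (χ (avoids? S u v ×-dec yes on) * ωd u v) ∎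
    go : (u≟v : Dec (u ≡ v)) → M ≤ total + 1 * (χ u≟v * M)
    go (yes _) = begin
      M                       ≡⟨ trans (*-identityˡ _) (*-identityˡ M) ⟨
      1 * (1 * M)             ≤⟨ m≤n+m _ total ⟩
      total + 1 * (1 * M)     ∎
    go (no u≢v) = begin
      M                                       ≡⟨ *-ωd u≢v ⟨
      -- Of the d(u,v) + 1 vertices on the path, d(u,v) suffice.
      d u v * ωd u v                          ≤⟨ *-monoˡ-≤ (ωd u v) (≤-trans (n≤1+n _) (on-count u v)) ⟩
      sum (λ x → χ (on? x u v)) * ωd u v      ≡⟨ *-distribʳ-sum (ωd u v) (λ x → χ (on? x u v)) ⟩
      sum (λ x → χ (on? x u v) * ωd u v)      ≤⟨ sum-mono term ⟩
      total                                   ≤⟨ m≤m+n total _ ⟩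
      total + 1 * (0 * M)                     ∎

  -- The bound N(N - 1) on the total gain, scaled by n ! and freed of subtraction: sum over all
  -- pairs in the component, move x outermost, and let the diagonal account for N · M.
  average-gain : ∀ c → component c * (component c * M) ≤
    sum (λ x → χ (avoids? S c x) * gain x) + component c * M
  average-gain c = begin
    component c * (component c * M)
      ≡⟨ cong (component c *_) (*-distribʳ-sum M χc) ⟩
    component c * sum (λ v → χc v * M)
      ≡⟨ ∑∑-* χc (λ v → χc v * M) ⟨
    (∑∑ λ u v → χc u * (χc v * M))
      ≤⟨ ∑∑-mono (average-pointwise c) ⟩
    (∑∑ λ u v → sum (λ x → χc x * through S x u v) + χc u * (χ (u ≟ v) * M))
      ≡⟨ ∑∑-+ (λ u v → sum (λ x → χc x * through S x u v)) (λ u v → χc u * (χ (u ≟ v) * M)) ⟩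
    (∑∑ λ u v → sum (λ x → χc x * through S x u v)) + (∑∑ λ u v → χc u * (χ (u ≟ v) * M))
      ≡⟨ cong₂ _+_ sum-gain sum-diagonal ⟩
    sum (λ x → χc x * gain x) + component c * M ∎
    where
    open ≤-Reasoning
    χc : Fin n → ℕ
    χc x = χ (avoids? S c x)
    sum-gain : (∑∑ λ u v → sum (λ x → χc x * through S x u v)) ≡ sum (λ x → χc x * gain x)
    sum-gain = begin-equality
      (∑∑ λ u v → sum (λ x → χc x * through S x u v))
        ≡⟨ sum-cong-≗ (λ u → ∑-comm (λ v x → χc x * through S x u v)) ⟩
      (∑∑ λ u x → sum (λ v → χc x * through S x u v))
        ≡⟨ ∑-comm (λ u x → sum (λ v → χc x * through S x u v)) ⟩
      (∑∑ λ x u → sum (λ v → χc x * through S x u v))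
        ≡⟨ ∑∑-cong (λ x u → *-distribˡ-sum (χc x) (through S x u)) ⟨
      (∑∑ λ x u → χc x * sum (through S x u))
        ≡⟨ sum-cong-≗ (λ x → *-distribˡ-sum (χc x) (λ u → sum (through S x u))) ⟨
      sum (λ x → χc x * gain x) ∎
    sum-diagonal : (∑∑ λ u v → χc u * (χ (u ≟ v) * M)) ≡ component c * M
    sum-diagonal = begin-equality
      (∑∑ λ u v → χc u * (χ (u ≟ v) * M))
        ≡⟨ sum-cong-≗ (λ u → *-distribˡ-sum (χc u) (λ v → χ (u ≟ v) * M)) ⟨
      sum (λ u → χc u * sum (λ v → χ (u ≟ v) * M))
        ≡⟨ sum-cong-≗ (λ u → cong (χc u *_) (sum-δ-* u M)) ⟩
      sum (λ u → χc u * M)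
        ≡⟨ *-distribʳ-sum M χc ⟨
      component c * M ∎

  module _ (1≤k : 1 ≤ ∣ S ∣) (minimal : ∀ S′ → ∣ S′ ∣ ≡ ∣ S ∣ → energy S ≤ energy S′) where

    gain≤cost : ∀ {s x} → s ∈ S → x ∉ S → gain x ≤ cost s x
    gain≤cost {s} {x} s∈S x∉S = +-cancelˡ-≤ (energy S) (gain x) (cost s x)
      (≤-trans (+-monoˡ-≤ (gain x) (minimal (swap S s x) (∣swap∣ S s∈S x∉S))) (swap-energy s x))

    -- Let p be the neighbour of s towards r. Exchanging s for p gives the bound when p ∉ S. If p ∈
    -- S, then p blocks every vertex above s, and if s = r, every vertex near s is below it; in both
    -- cases the reach is 0.
    reach-bound : ∀ r {s} → s ∈ S → reach r s ≤ size r s * (size r s * M) + M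
    reach-bound r {s} s∈S with s ≟ r
    ... | yes refl = ≤-trans (≤-reflexive (reach≡0 r λ y ab → proj₂ ab (on-right y r))) z≤n
    ... | no s≢r with toward s≢r
    ...   | p , sp , on-p with p ∈? S
    ...     | no p∉S  = ≤-trans (reach≤ r s∈S sp on-p)
                          (+-monoˡ-≤ M (≤-trans (gain≤cost s∈S p∉S) (cost-neighbour≤ r s∈S sp on-p)))
    ...     | yes p∈S = ≤-trans (≤-reflexive (reach≡0 r none)) z≤n
      where
      none : ∀ y → ¬ Above r s y
      none y ab with proj₁ ab p p∈S (above-through r s∈S sp on-p ab)
      ... | refl = contradiction (trans (sym sp) (d-refl s)) λ ()

    -- By minimality and `cost≤`, each x in the component gains at most K, so averaging gives N · (N
    -- · M) ≤ N · (K + M). The case N = 0 is set apart because N gets cancelled. The root is c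
    -- itself.
    component≤cube : ∀ c {s} → s ∈ S → component c ≤ 6 * size c s ^ 3
    component≤cube c {s} s∈S with component c ≟ℕ 0
    ... | yes N≡0 = ≤-trans (≤-reflexive N≡0) z≤n
    ... | no N≢0  = *-cancelʳ-≤ N (6 * B ^ 3) M (*-cancelˡ-≤ N (begin
      N * (N * M)                                  ≤⟨ average-gain c ⟩
      sum (λ x → χ (avoids? S c x) * gain x) + N * M ≤⟨ +-monoˡ-≤ (N * M) (sum-mono gain-pointwise) ⟩
      sum (λ x → χ (avoids? S c x) * K) + N * M    ≡⟨ cong (_+ N * M) (*-distribʳ-sum K (λ x → χ (avoids? S c x))) ⟨
      N * K + N * M                                ≡⟨ *-distribˡ-+ N K M ⟨
      N * (K + M)                                  ≤⟨ *-monoʳ-≤ N K+M≤ ⟩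
      N * (6 * B ^ 3 * M)                          ∎))
      where
      open ≤-Reasoning
      N = component c
      B = size c s
      R = reach c s
      K = B * (B * M) + B * R + R * B
      instance
        _ = ≢-nonZero N≢0
        _ = >-nonZero (1≤size c s)
        _ = n !≢0
      gain-pointwise : ∀ x → χ (avoids? S c x) * gain x ≤ χ (avoids? S c x) * K
      gain-pointwise x with avoids? S c x
      ... | no _   = z≤n
      ... | yes cx = *-monoʳ-≤ 1 (≤-trans (gain≤cost s∈S (λ x∈S → cx x x∈S (on-right c x))) (cost≤ c s x))
      expand : ∀ b m → b * (b * m) + b * (b * (b * m) + m) + (b * (b * m) + m) * b + m ≡
                       (2 * (b * (b * b)) + (b * b + (2 * b + 1))) * m
      expand = solve-∀
      collect : ∀ x → 2 * x + (x + (2 * x + x)) ≡ 6 * x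
      collect = solve-∀
      B≤B³ : B ≤ B * (B * B)
      B≤B³ = m≤m*n B (B * B) {{m*n≢0 B B}}
      K+M≤ : K + M ≤ 6 * B ^ 3 * M
      K+M≤ = begin
        K + M
          ≤⟨ +-monoˡ-≤ M (+-mono-≤ (+-monoʳ-≤ (B * (B * M)) (*-monoʳ-≤ B (reach-bound c s∈S)))
                                   (*-monoˡ-≤ B (reach-bound c s∈S))) ⟩
        B * (B * M) + B * (B * (B * M) + M) + (B * (B * M) + M) * B + M
          ≡⟨ expand B M ⟩
        -- As B ≥ 1, each of B², B and 1 is at most B³; the constant 6 is 2 + 1 + 2 + 1.
        (2 * (B * (B * B)) + (B * B + (2 * B + 1))) * M
          ≤⟨ *-monoˡ-≤ M (+-monoʳ-≤ (2 * (B * (B * B))) (+-mono-≤ (m≤n*m (B * B) B)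
               (+-mono-≤ (*-monoʳ-≤ 2 B≤B³) (≤-trans (1≤size c s) B≤B³)))) ⟩
        (2 * (B * (B * B)) + (B * (B * B) + (2 * (B * (B * B)) + B * (B * B)))) * M
          ≡⟨ cong (_* M) (collect (B * (B * B))) ⟩
        6 * (B * (B * B)) * M
          ≡⟨ cong (λ b → 6 * (B * (B * b)) * M) (*-identityʳ B) ⟨
        6 * B ^ 3 * M ∎

    component-bound : ∀ c → component c * ∣ S ∣ ^ 5 ≤ 6 * n ^ 5
    component-bound c with small-size c 1≤k
    ... | s , s∈S , kB≤n = begin
      component c * k ^ 5          ≤⟨ *-monoˡ-≤ (k ^ 5) (component≤cube c s∈S) ⟩
      6 * B ^ 3 * k ^ 5            ≡⟨ regroup B k ⟩
      -- Three factors k turn B³ into at most n³; the other two are bounded by n² through k ≤ n.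
      6 * ((k * B) ^ 3 * k ^ 2)    ≤⟨ *-monoʳ-≤ 6 (*-mono-≤ (^-monoˡ-≤ 3 kB≤n) (^-monoˡ-≤ 2 (∣p∣≤n S))) ⟩
      6 * (n ^ 3 * n ^ 2)          ≡⟨ cong (6 *_) (^-distribˡ-+-* n 3 2) ⟨
      6 * n ^ 5                    ∎
      where
      open ≤-Reasoning
      k = ∣ S ∣
      B = size c s
      regroup : ∀ b k → 6 * (b * (b * (b * 1))) * (k * (k * (k * (k * (k * 1))))) ≡
                        6 * ((k * b) * ((k * b) * ((k * b) * 1)) * (k * (k * 1)))
      regroup = solve-∀

-- Trees as metric spaces

∨-true : ∀ a {b} → a ∨ b ≡ true → a ≡ true ⊎ b ≡ true
∨-true true  _ = inj₁ refl
∨-true false p = inj₂ p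

anyFin-sound : (f : Fin n → Bool) → anyFin f ≡ true → ∃ λ i → f i ≡ true
anyFin-sound {suc n} f p with ∨-true (f zero) p
... | inj₁ q = zero , q
... | inj₂ q with anyFin-sound (f ∘ suc) q
...   | i , r = suc i , r

anyFin-complete : (f : Fin n → Bool) (i : Fin n) → f i ≡ true → anyFin f ≡ true
anyFin-complete f zero    p rewrite p = refl
anyFin-complete f (suc i) p rewrite anyFin-complete (f ∘ suc) i p = ∨-zeroʳ (f zero)

==-sound : (u v : Fin n) → (u == v) ≡ true → u ≡ v
==-sound zero    zero    _ = refl
==-sound (suc u) (suc v) p = cong suc (==-sound u v p)

==-refl : (u : Fin n) → (u == u) ≡ true
==-refl zero    = refl
==-refl (suc u) = ==-refl u

-- Walks and shortest walks after deleting a vertex set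

module Walks {n} (G : Graph n) where

  record Edge (S : Subset n) (u v : Fin n) : Set where
    constructor edge
    field
      joined : adj G u v ≡ true
      left∉  : u ∉ S
      right∉ : v ∉ S
  open Edge

  not-lookup : ∀ {S : Subset n} {u} → not (lookup S u) ≡ true → u ∉ S
  not-lookup p u∈S rewrite []=⇒lookup u∈S = contradiction p λ ()

  lookup-∉ : ∀ {S : Subset n} {u} → u ∉ S → not (lookup S u) ≡ true
  lookup-∉ {S} {u} u∉S with lookup S u in eq
  ... | false = refl
  ... | true  = contradiction (lookup⇒[]= u S eq) u∉S

  adjDel-sound : ∀ {S u v} → adjDel G S u v ≡ true → Edge S u v
  adjDel-sound {S} {u} {v} p = edge (∧-conicalˡ (adj G u v) _ p)
    (not-lookup (∧-conicalˡ (not (lookup S u)) _ q))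
    (not-lookup (∧-conicalʳ (not (lookup S u)) _ q))
    where q = ∧-conicalʳ (adj G u v) _ p

  adjDel-complete : ∀ {S u v} → Edge S u v → adjDel G S u v ≡ true
  adjDel-complete {S} (edge p u∉S v∉S) = cong₂ _∧_ p (cong₂ _∧_ (lookup-∉ {S} u∉S) (lookup-∉ {S} v∉S))

  edge-sym : ∀ {S u v} → Edge S u v → Edge S v u
  edge-sym {u = u} {v} (edge p u∉S v∉S) = edge (trans (Graph.sym G v u) p) v∉S u∉S

  infixl 5 _▷_ _++_

  -- Edges are appended at the end, as in the recursion of `within`. The empty walk is allowed at a
  -- vertex of S too, which is why later statements assume u ∉ S.
  data Walk (S : Subset n) (u : Fin n) : Fin n → ℕ → Set where
    []  : Walk S u u 0
    _▷_ : ∀ {w v m} → Walk S u w m → Edge S w v → Walk S u v (suc m)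

  private variable
    S S′ : Subset n
    u v w x y : Fin n
    k m : ℕ

  _++_ : Walk S u w k → Walk S w v m → Walk S u v (m + k)
  p ++ []      = p
  p ++ (q ▷ e) = (p ++ q) ▷ e

  _◁_ : Edge S u w → Walk S w v m → Walk S u v (suc m)
  e ◁ []       = [] ▷ e
  e ◁ (p ▷ e′) = (e ◁ p) ▷ e′

  reverse : Walk S u v m → Walk S v u m
  reverse []      = []
  reverse (p ▷ e) = edge-sym e ◁ reverse p

  weaken : S ⊆ S′ → Walk S′ u v m → Walk S u v m
  weaken S⊆S′ []      = []
  weaken S⊆S′ (p ▷ edge a l r) = weaken S⊆S′ p ▷ edge a (l ∘ S⊆S′) (r ∘ S⊆S′)

  end∉ : u ∉ S → Walk S u v m → v ∉ S
  end∉ u∉S []      = u∉S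
  end∉ u∉S (p ▷ e) = right∉ e

  within-walk : ∀ m → within G S m u v ≡ true → ∃ λ k → k ≤ m × Walk S u v k
  within-walk {u = u} {v} zero p with ==-sound u v p
  ... | refl = 0 , z≤n , []
  within-walk {S} {u} {v} (suc m) p with ∨-true (within G S m u v) p
  ... | inj₁ q with within-walk m q
  ...   | k , k≤m , walk = k , m≤n⇒m≤1+n k≤m , walk
  within-walk {S} {u} {v} (suc m) p | inj₂ q with anyFin-sound _ q
  ... | w , r with within-walk m (∧-conicalˡ (within G S m u w) _ r)
  ...   | k , k≤m , walk = suc k , s≤s k≤m , walk ▷ adjDel-sound (∧-conicalʳ (within G S m u w) _ r)

  within-suc : ∀ m → within G S m u v ≡ true → within G S (suc m) u v ≡ true
  within-suc m p rewrite p = refl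

  within-mono : k ≤′ m → within G S k u v ≡ true → within G S m u v ≡ true
  within-mono ≤′-refl       p = p
  within-mono {m = suc m} (≤′-step k≤m) p = within-suc m (within-mono k≤m p)

  walk-within-exact : Walk S u v m → within G S m u v ≡ true
  walk-within-exact {u = u} [] = ==-refl u
  walk-within-exact {S} {u} {v} (_▷_ {w} {m = m} p e)
    rewrite anyFin-complete (λ w → within G S m u w ∧ adjDel G S w v) w
              (cong₂ _∧_ (walk-within-exact p) (adjDel-complete e)) = ∨-zeroʳ _

  walk-within : Walk S u v k → k ≤ m → within G S m u v ≡ true
  walk-within p k≤m = within-mono (≤⇒≤′ k≤m) (walk-within-exact p)

  record Shortest (S : Subset n) (u v : Fin n) (m : ℕ) : Set where
    constructor shortest
    field
      walk : Walk S u v m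
      min  : ∀ {k} → Walk S u v k → m ≤ k
  open Shortest public

  -- A walk of length at most m would contradict the failed search at m, so the walk found has
  -- length exactly m + 1 and none is shorter.
  shortest-suc : within G S m u v ≡ false → within G S (suc m) u v ≡ true → Shortest S u v (suc m)
  shortest-suc {S} {m} {u} {v} no-m yes-m with within-walk (suc m) yes-m
  ... | k , k≤1+m , p with m≤n⇒m<n∨m≡n k≤1+m
  ...   | inj₁ k<1+m = contradiction (trans (sym no-m) (walk-within p (≤-pred k<1+m))) λ ()
  ...   | inj₂ refl  = shortest p λ q → ≰⇒> λ k≤m →
                         contradiction (trans (sym no-m) (walk-within q k≤m)) λ ()

  least : ∀ m → within G S m u v ≡ true → ∃ (Shortest S u v)
  least {u = u} {v} zero p with ==-sound u v p
  ... | refl = 0 , shortest [] λ _ → z≤n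
  least {S} {u} {v} (suc m) p with within G S m u v Bool.≟ true
  ... | yes q = least m q
  ... | no ¬q = suc m , shortest-suc (¬-not ¬q) p

  shortest-unique : Shortest S u v k → Shortest S u v m → k ≡ m
  shortest-unique p q = ≤-antisym (min p (walk q)) (min q (walk p))

  -- The vertices of a walk, counted backwards from its end.
  vertex : Walk S u v m → ℕ → Fin n
  vertex {v = v} _       zero    = v
  vertex {u = u} []      (suc i) = u
  vertex         (p ▷ e) (suc i) = vertex p i

  vertex-last : (p : Walk S u v m) → vertex p m ≡ u
  vertex-last []      = refl
  vertex-last (p ▷ e) = vertex-last p

  vertex-edge : (p : Walk S u v m) → ∀ {i} → i < m → Edge S (vertex p (suc i)) (vertex p i)
  vertex-edge ([] ▷ e)      {zero}  _         = e
  vertex-edge (p ▷ _ ▷ e)   {zero}  _         = e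
  vertex-edge (p ▷ e)       {suc i} (s≤s i<m) = vertex-edge p i<m

  vertex∉ : u ∉ S → (p : Walk S u v m) → ∀ i → vertex p i ∉ S
  vertex∉ u∉S p       zero    = end∉ u∉S p
  vertex∉ u∉S []      (suc i) = u∉S
  vertex∉ u∉S (p ▷ e) (suc i) = vertex∉ u∉S p i

  -- Prefixes of a shortest walk are shortest: a shorter replacement, extended by the remaining
  -- edge, would beat the whole walk.
  vertex-dist : (p : Walk S u v m) → (∀ {k} → Walk S u v k → m ≤ k) →
                ∀ {i} → i ≤ m → Shortest S u (vertex p i) (m ∸ i)
  vertex-dist p       min {zero}  _         = shortest p min
  vertex-dist (p ▷ e) min {suc i} (s≤s i≤m) =
    vertex-dist p (λ q → ≤-pred (min (q ▷ e))) i≤m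

  -- The cycle is x followed by the walk from b back to a. Its vertices differ from x because the
  -- walk avoids x, and from one another because their distances from a in G - x differ. As a ≠ b,
  -- the walk has an edge, so the length is at least 3.
  branch-cycle : ∀ {x a b} → adj G x a ≡ true → adj G x b ≡ true → a ≢ b →
                 Shortest ⁅ x ⁆ a b m → Cycle G
  branch-cycle {x = x} {a} {b} xa xb a≢b (shortest [] _) = contradiction refl a≢b
  branch-cycle {m = m@(suc _)} {x} {a} {b} xa xb a≢b (shortest p min) = record
    { len   = suc (suc m)
    ; len≥3 = s≤s (s≤s (s≤s z≤n))
    ; vtx   = vtx
    ; inj   = λ {i} {j} → inj {i} {j}
    ; step  = step
    ; close = close
    }
    where
    a∉ : a ∉ ⁅ x ⁆
    a∉ a∈ with x∈⁅y⁆⇒x≡y x a∈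
    ... | refl = contradiction (trans (sym (irrefl G x)) xa) λ ()
    vtx : Fin (suc (suc m)) → Fin n
    vtx zero    = x
    vtx (suc i) = vertex p (toℕ i)
    x≢vertex : ∀ i → x ≢ vertex p i
    x≢vertex i eq = vertex∉ a∉ p i (subst (_∈ ⁅ x ⁆) eq (x∈⁅x⁆ x))
    inj : ∀ {i j} → vtx i ≡ vtx j → i ≡ j
    inj {zero}  {zero}  _  = refl
    inj {zero}  {suc j} eq = contradiction eq (x≢vertex (toℕ j))
    inj {suc i} {zero}  eq = contradiction (sym eq) (x≢vertex (toℕ i))
    inj {suc i} {suc j} eq = cong suc (toℕ-injective (∸-cancelˡ-≡ (toℕ≤pred[n] i) (toℕ≤pred[n] j)
      (shortest-unique (vertex-dist p min (toℕ≤pred[n] i))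
        (subst (λ w → Shortest ⁅ x ⁆ a w (m ∸ toℕ j)) (sym eq) (vertex-dist p min (toℕ≤pred[n] j))))))
    step : ∀ i j → suc (toℕ i) ≡ toℕ j → adj G (vtx i) (vtx j) ≡ true
    step zero    (suc zero) refl = xb
    step (suc i) (suc j)    eq   = subst (λ k → adj G (vertex p (toℕ i)) (vertex p k) ≡ true)
      (suc-injective eq) (joined (edge-sym (vertex-edge p i<m)))
      where
      i<m : toℕ i < m
      i<m = subst (_≤ m) (sym (suc-injective eq)) (toℕ≤pred[n] j)
    close : ∀ i j → suc (toℕ i) ≡ suc (suc m) → toℕ j ≡ 0 → adj G (vtx i) (vtx j) ≡ true
    close zero    zero ()
    close (suc i) zero eq _ = trans (Graph.sym G _ x) (trans (cong (adj G x)
      (trans (cong (vertex p) (suc-injective (suc-injective eq))) (vertex-last p))) xa)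

-- Paths and separation in a tree

module Tree {n} (G : Graph n) (connected : Connected G) (acyclic : Acyclic G) where
  open Walks G public

  ∅ : Subset n
  ∅ = noVertices

  abstract
    distance : ∀ u v → ∃ (Shortest ∅ u v)
    distance u v with connected u v
    ... | m , p = least m p

  dst : Fin n → Fin n → ℕ
  dst u v = proj₁ (distance u v)

  geodesic : ∀ u v → Walk ∅ u v (dst u v)
  geodesic u v = walk (proj₂ (distance u v))

  dst≤ : ∀ {u v k} → Walk ∅ u v k → dst u v ≤ k
  dst≤ {u} {v} = min (proj₂ (distance u v))

  forget : ∀ {S u v k} → Walk S u v k → Walk ∅ u v k
  forget = weaken λ x∈∅ → contradiction x∈∅ ∉⊥

  metric : Metric n
  metric = record
    { d      = dst
    ; d-refl = λ u → n≤0⇒n≡0 (dst≤ [])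
    ; d-zero = λ {u} {v} → zero-walk (geodesic u v)
    ; d-sym  = λ u v → ≤-antisym (dst≤ (reverse (geodesic v u))) (dst≤ (reverse (geodesic u v)))
    ; d-tri  = λ u x v → subst (dst u v ≤_) (+-comm (dst x v) (dst u x)) (dst≤ (geodesic u x ++ geodesic x v))
    }
    where
    zero-walk : ∀ {u v m} → Walk ∅ u v m → m ≡ 0 → u ≡ v
    zero-walk [] _ = refl

  open Metric metric

  edge-dist : ∀ {S u v} → Edge S u v → d u v ≤ 1
  edge-dist {S} e = dst≤ (forget ([] ▷ e))

  -- Take the vertex before v on a geodesic: its prefix and last edge bound both distances from
  -- above, and the triangle inequality makes the bounds tight.
  pred-on : ∀ {u v m} → d u v ≡ suc m → ∃ λ w → Edge ∅ w v × d u w ≡ m × d w v ≡ 1 × On w u v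
  pred-on {u} {v} {m} eq with subst (Walk ∅ u v) eq (geodesic u v)
  ... | _▷_ {w} p e = w , e , duw , dwv , trans (cong₂ _+_ duw dwv) (trans (+-comm m 1) (sym eq))
    where
    open ≤-Reasoning
    tri : suc m ≤ d u w + d w v
    tri = subst (_≤ d u w + d w v) eq (d-tri u w v)
    duw : d u w ≡ m
    duw = ≤-antisym (dst≤ p) (≤-pred (begin
      suc m         ≤⟨ tri ⟩
      d u w + d w v ≤⟨ +-monoʳ-≤ (d u w) (edge-dist e) ⟩
      d u w + 1     ≡⟨ +-comm (d u w) 1 ⟩
      suc (d u w)   ∎))
    dwv : d w v ≡ 1
    dwv = ≤-antisym (edge-dist e) (+-cancelˡ-≤ m 1 (d w v) (begin
      m + 1         ≡⟨ +-comm m 1 ⟩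
      suc m         ≤⟨ tri ⟩
      d u w + d w v ≡⟨ cong (_+ d w v) duw ⟩
      m + d w v     ∎))

  -- A geodesic only visits the interval between its ends.
  avoiding-walk : ∀ {S u v} m → d u v ≡ m → Avoids S u v → Walk S u v m
  avoiding-walk {S} {u} {v} zero eq av = subst (λ v → Walk S u v 0) (d-zero eq) []
  avoiding-walk {S} {u} {v} (suc m) eq av with pred-on eq
  ... | w , e , duw , _ , on = avoiding-walk m duw av′
                                 ▷ edge (Edge.joined e) (λ w∈S → av w w∈S on) (λ v∈S → av v v∈S (on-right u v))
    where
    av′ : Avoids S u w
    av′ y y∈S q = av y y∈S (on-extend on q)

  off-walk : ∀ {x u v} → ¬ On x u v → Walk ⁅ x ⁆ u v (d u v)
  off-walk {x} {u} {v} ¬on = avoiding-walk (d u v) refl λ y y∈ on →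
    ¬on (subst (λ z → On z u v) (x∈⁅y⁆⇒x≡y x y∈) on)

  toward : ∀ {s r} → s ≢ r → ∃ λ p → d s p ≡ 1 × On p s r
  toward {s} {r} s≢r with d r s in eq
  ... | zero  = contradiction (sym (d-zero eq)) s≢r
  ... | suc m with pred-on eq
  ...   | p , _ , _ , dps , on = p , trans (d-sym s p) dps , on-sym on

  dist1-adj : ∀ {s p} → d s p ≡ 1 → adj G s p ≡ true
  dist1-adj {s} {p} eq with pred-on eq
  ... | w , e , dsw , _ with d-zero dsw
  ...   | refl = Edge.joined e

  -- The one place where acyclicity enters: a shortest walk from a to b in G - x closes to a cycle
  -- through x.
  no-branch : ∀ {x a b m} → d x a ≡ 1 → d x b ≡ 1 → a ≢ b → ¬ Walk ⁅ x ⁆ a b m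
  no-branch {m = m} xa xb a≢b p =
    acyclic (branch-cycle (dist1-adj xa) (dist1-adj xb) a≢b (proj₂ (least m (walk-within p ≤-refl))))

  not-behind : ∀ {s p y} → d s p ≡ 1 → On p s y → ¬ On s p y
  not-behind {s} {p} sp on q with on-antisym on q
  ... | refl = contradiction (trans (sym sp) (d-refl s)) λ ()

  -- Let a and b be the neighbours of x towards u and v. A walk from u to v missing x would extend
  -- to one from a to b missing x.
  on-separates : ∀ {x u v m} → On x u v → x ≢ u → x ≢ v → ¬ Walk ⁅ x ⁆ u v m
  on-separates {x} {u} {v} on x≢u x≢v p with toward x≢u | toward x≢v
  ... | a , xa , on-a | b , xb , on-b = no-branch xa xb a≢b
        (off-walk (not-behind xa on-a) ++ p ++ reverse (off-walk (not-behind xb on-b)))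
    where
    open ≤-Reasoning
    a≢b : a ≢ b
    -- If a = b, the route through a instead of x would be shorter by 2 than d(u,v).
    a≢b refl = contradiction (begin
      2 + d u v                       ≤⟨ +-monoʳ-≤ 2 (d-tri u a v) ⟩
      2 + (d u a + d a v)             ≡⟨ shift (d u a) (d a v) ⟩
      (d u a + 1) + (1 + d a v)       ≡⟨ cong₂ _+_ (cong (d u a +_) (trans (d-sym a x) xa)) (cong (_+ d a v) xb) ⟨
      (d u a + d a x) + (d x a + d a v) ≡⟨ cong₂ _+_ (on-sym on-a) on-b ⟩
      d u x + d x v                   ≡⟨ on ⟩
      d u v                           ∎) (<⇒≱ (m<n+m (d u v) (s≤s z≤n)))
      where
      shift : ∀ y z → 2 + (y + z) ≡ (y + 1) + (1 + z)
      shift = solve-∀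

  -- If x were off both paths, joining them at w would give a walk from u to v that misses x.
  on-split : ∀ {x u v} w → On x u v → On x u w ⊎ On x w v
  on-split {x} {u} {v} w on with on? x u w | on? x w v
  ... | yes q | _     = inj₁ q
  ... | no _  | yes q = inj₂ q
  ... | no ¬p | no ¬q = contradiction (off-walk ¬p ++ off-walk ¬q)
        (on-separates on (λ { refl → ¬p (on-left x w) }) (λ { refl → ¬q (on-right w x) }))

  -- Otherwise the neighbour a of s towards v differs from p, and the paths a-v and v-p, both
  -- missing s, connect two neighbours of s.
  on-edge : ∀ {s p} v → d s p ≡ 1 → On s p v ⊎ On p s v
  on-edge {s} {p} v sp with on? s p v | on? p s v | s ≟ v
  ... | yes q | _     | _        = inj₁ q
  ... | no _  | yes q | _        = inj₂ q
  ... | no ¬q | no _  | yes refl = contradiction (on-right p s) ¬q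
  ... | no ¬q | no ¬r | no s≢v with toward s≢v
  ...   | a , sa , on-a = contradiction (off-walk (not-behind sa on-a) ++ reverse (off-walk ¬q))
                            (no-branch sa sp λ { refl → ¬r on-a })

  -- Induction along a geodesic: the interval up to the predecessor w is contained in the one up to
  -- v, and v itself is new because it is farther from u than w.
  on-count : ∀ {u} m v → d u v ≡ m → suc m ≤ sum (λ x → χ (on? x u v))
  on-count {u} zero v eq = subst (_≤ sum (λ x → χ (on? x u v))) (χ-yes (on? v u v) (on-right u v))
    (term≤sum (λ x → χ (on? x u v)) v)
  on-count {u} (suc m) v eq with pred-on eq
  ... | w , _ , duw , _ , on-w = begin
    suc (suc m)                                               ≤⟨ s≤s (on-count m w duw) ⟩
    suc (sum (λ x → χ (on? x u w)))                           ≡⟨ cong (_+ sum (λ x → χ (on? x u w))) (sum-δ v) ⟨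
    sum (λ x → χ (v ≟ x)) + sum (λ x → χ (on? x u w))         ≡⟨ ∑-distrib-+ (λ x → χ (v ≟ x)) (λ x → χ (on? x u w)) ⟨
    sum (λ x → χ (v ≟ x) + χ (on? x u w))                     ≤⟨ sum-mono pointwise ⟩
    sum (λ x → χ (on? x u v))                                 ∎
    where
    open ≤-Reasoning
    v-off : ¬ On v u w
    v-off q = contradiction (begin
      suc m           ≡⟨ eq ⟨
      d u v           ≤⟨ m≤m+n _ (d v w) ⟩
      d u v + d v w   ≡⟨ q ⟩
      d u w           ≡⟨ duw ⟩
      m               ∎) (<⇒≱ ≤-refl)
    pointwise : ∀ x → χ (v ≟ x) + χ (on? x u w) ≤ χ (on? x u v)
    pointwise x with v ≟ x
    ... | no _     = χ-mono (on? x u w) (on? x u v) (on-extend on-w)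
    ... | yes refl = ≤-reflexive (trans (cong suc (χ-no (on? v u w) v-off)) (sym (χ-yes (on? v u v) (on-right u v))))

  treeMetric : TreeMetric n
  treeMetric = record
    { metric   = metric
    ; on-split = on-split
    ; on-edge  = on-edge
    ; toward   = toward
    ; on-count = λ u v → on-count (d u v) v refl
    }

  -- Converse of `avoiding-walk`: a vertex of S on the path would separate u from v.
  walk-avoids : ∀ {S u v m} → u ∉ S → Walk S u v m → Avoids S u v
  walk-avoids {S} {u} {v} u∉S p y y∈S on = on-separates on
    (λ { refl → u∉S y∈S }) (λ { refl → end∉ u∉S p y∈S })
    (weaken (λ z∈ → subst (_∈ S) (sym (x∈⁅y⁆⇒x≡y y z∈)) y∈S) p)

  dist<n : ∀ u v → d u v < n
  dist<n u v = ≤-trans (on-count (d u v) v refl) (sum≤n λ x → χ≤1 (on? x u v))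

  -- The failing case also records that `within` is false, which is what makes a success at the next
  -- length shortest.
  search-spec : ∀ S u v k →
    (∃ λ m → searchDist G S u v k ≡ just m × Shortest S u v m) ⊎
    (searchDist G S u v k ≡ nothing × within G S k u v ≡ false)
  search-spec S u v zero with u == v in eq
  ... | false = inj₂ (refl , refl)
  ... | true with ==-sound u v eq
  ...   | refl = inj₁ (0 , refl , shortest [] λ _ → z≤n)
  search-spec S u v (suc k) with search-spec S u v k
  ... | inj₁ (m , found , sh) rewrite found = inj₁ (m , refl , sh)
  ... | inj₂ (none , no-k) rewrite none with within G S (suc k) u v in eq
  ...   | true  = inj₁ (suc k , refl , shortest-suc no-k eq)
  ...   | false = inj₂ (refl , refl)

  -- The tree geodesic survives the deletion of S, so the distance is unchanged; it is below n,
  -- within the range of the search.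
  dist-avoids : ∀ {S u v} → Avoids S u v → dist G S u v ≡ just (d u v)
  dist-avoids {S} {u} {v} av with search-spec S u v n
  ... | inj₁ (m , found , sh) = trans found (cong just (≤-antisym (min sh p) (dst≤ (forget (walk sh)))))
    where p = avoiding-walk (d u v) refl av
  ... | inj₂ (_ , no-n) = contradiction (trans (sym no-n) (walk-within p (<⇒≤ (dist<n u v)))) λ ()
    where p = avoiding-walk (d u v) refl av

  dist-blocked : ∀ {S u v} → u ∉ S → ¬ Avoids S u v → dist G S u v ≡ nothing
  dist-blocked {S} {u} {v} u∉S ¬av with search-spec S u v n
  ... | inj₁ (_ , _ , sh)  = contradiction (walk-avoids u∉S (walk sh)) ¬av
  ... | inj₂ (none , _)    = none

-- Clearing denominators

-- The second field stores the denominator minus one, so the value is a / (q + 1).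
fracᵘ : ℕ → ℕ → ℚᵘ.ℚᵘ
fracᵘ q a = ℚᵘ.mkℚᵘ (ℤ.+ a) q

abstract
  frac : ℕ → ℕ → ℚ
  frac q a = fromℚᵘ (fracᵘ q a)

  toℚᵘ-frac : ∀ q a → toℚᵘ (frac q a) ℚᵘ.≃ fracᵘ q a
  toℚᵘ-frac q a = ℚ.toℚᵘ-fromℚᵘ (fracᵘ q a)

  frac-0 : ∀ q → frac q 0 ≡ 0ℚ
  frac-0 q = ℚ.0/n≡0 (suc q)

  frac-inverse : ∀ q m {a} → suc m * a ≡ suc q → (ℤ.+ 1) ℚ./ suc m ≡ frac q a
  frac-inverse q m {a} eq = ℚ.fromℚᵘ-cong {ℚᵘ.mkℚᵘ (ℤ.+ 1) m} {fracᵘ q a} (ℚᵘ.*≡* (begin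
    ℤ.+ 1 ℤ.* ℤ.+ suc q   ≡⟨ ℤ.*-identityˡ (ℤ.+ suc q) ⟩
    ℤ.+ suc q             ≡⟨ cong ℤ.+_ eq ⟨
    ℤ.+ (suc m * a)       ≡⟨ cong ℤ.+_ (*-comm (suc m) a) ⟩
    ℤ.+ (a * suc m)       ≡⟨ ℤ.pos-* a (suc m) ⟩
    ℤ.+ a ℤ.* ℤ.+ suc m   ∎))
    where open ≡-Reasoning

frac-+ : ∀ q a b → frac q a ℚ.+ frac q b ≡ frac q (a + b)
frac-+ q a b = ℚ.toℚᵘ-injective (begin
  toℚᵘ (frac q a ℚ.+ frac q b)           ≈⟨ ℚ.toℚᵘ-homo-+ (frac q a) (frac q b) ⟩
  toℚᵘ (frac q a) ℚᵘ.+ toℚᵘ (frac q b)   ≈⟨ ℚᵘ.+-cong {toℚᵘ (frac q a)} {fracᵘ q a} {toℚᵘ (frac q b)} {fracᵘ q b}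
                                              (toℚᵘ-frac q a) (toℚᵘ-frac q b) ⟩
  fracᵘ q a ℚᵘ.+ fracᵘ q b               ≈⟨ ℚᵘ.*≡* same ⟩
  fracᵘ q (a + b)                        ≈⟨ toℚᵘ-frac q (a + b) ⟨
  toℚᵘ (frac q (a + b))                  ∎)
  where
  open ℚᵘ.≃-Reasoning
  D = ℤ.+ suc q
  same : (ℤ.+ a ℤ.* D ℤ.+ ℤ.+ b ℤ.* D) ℤ.* D ≡ ℤ.+ (a + b) ℤ.* (D ℤ.* D)
  same = trans (cong (ℤ._* D) (sym (ℤ.*-distribʳ-+ D (ℤ.+ a) (ℤ.+ b)))) (ℤ.*-assoc (ℤ.+ (a + b)) D D)

frac-cancel-≤ : ∀ q {a b} → frac q a ℚ.≤ frac q b → a ≤ b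
frac-cancel-≤ q {a} {b} le = ℤ.drop‿+≤+ (ℤ.*-cancelʳ-≤-pos (ℤ.+ a) (ℤ.+ b) (ℤ.+ suc q) (ℚᵘ.drop-*≤* le′))
  where
  le′ : fracᵘ q a ℚᵘ.≤ fracᵘ q b
  le′ = ℚᵘ.≤-respʳ-≃ (toℚᵘ-frac q b) (ℚᵘ.≤-respˡ-≃ (toℚᵘ-frac q a) (ℚ.toℚᵘ-mono-≤ le))

sumFin-frac : ∀ q {f : Fin n → ℚ} {g : Fin n → ℕ} → (∀ i → f i ≡ frac q (g i)) → sumFin f ≡ frac q (sum g)
sumFin-frac {zero}  q eq = sym (frac-0 q)
sumFin-frac {suc n} q {g = g} eq =
  trans (cong₂ ℚ._+_ (eq zero) (sumFin-frac q (eq ∘ suc))) (frac-+ q (g zero) (sum (g ∘ suc)))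

-- From energy and intervals back to IGL and component sizes

module Minimizer {n} (G : Graph n) (connected : Connected G) (acyclic : Acyclic G) where
  open Tree G connected acyclic
  open TreeMetric treeMetric using (d; d-sym; d-zero; d-refl; avoids?; Avoids; avoids-sym; on-left; on-right; kept; energy; *-ωd)
  open Exchange treeMetric using (component; component-bound)

  -- One orientation of each unordered pair, selected by the same test as in `IGLdel`.
  half : Subset n → Fin n → Fin n → ℕ
  half S u v = if toℕ u <ᵇ toℕ v then kept S u v else 0

  kept-sym : ∀ S u v → kept S u v ≡ kept S v u
  kept-sym S u v = cong₂ _*_ (≤-antisym (χ-mono (avoids? S u v) (avoids? S v u) avoids-sym)
                                        (χ-mono (avoids? S v u) (avoids? S u v) avoids-sym))
                             (cong (ω n) (d-sym u v))

  kept-self : ∀ S u → kept S u u ≡ 0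
  kept-self S u = trans (cong (λ k → χ (avoids? S u u) * ω n k) (d-refl u)) (*-zeroʳ (χ (avoids? S u u)))

  kept-split : ∀ S u v → kept S u v ≡ half S u v + half S v u
  kept-split S u v with toℕ u <ᵇ toℕ v in p | toℕ v <ᵇ toℕ u in q
  ... | true  | false = sym (+-identityʳ _)
  ... | false | true  = kept-sym S u v
  ... | true  | true  = contradiction (<ᵇ⇒< (toℕ v) (toℕ u) (subst Bool.T (sym q) _))
                          (<-asym (<ᵇ⇒< (toℕ u) (toℕ v) (subst Bool.T (sym p) _)))
  -- Neither index is smaller, so u = v, and the diagonal carries weight 0.
  ... | false | false = trans (cong (kept S u) (sym u≡v)) (kept-self S u)
    where
    u≡v : u ≡ v
    u≡v = toℕ-injective (≤-antisym (≮⇒≥ λ lt → subst Bool.T q (<⇒<ᵇ lt))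
                                   (≮⇒≥ λ lt → subst Bool.T p (<⇒<ᵇ lt)))

  energy-half : ∀ S → energy S ≡ ∑∑ (half S) + ∑∑ (half S)
  energy-half S = begin
    energy S                                  ≡⟨ ∑∑-cong (kept-split S) ⟩
    (∑∑ λ u v → half S u v + half S v u)      ≡⟨ ∑∑-+ (half S) (λ u v → half S v u) ⟩
    ∑∑ (half S) + (∑∑ λ u v → half S v u)     ≡⟨ cong (∑∑ (half S) +_) (∑-comm (λ u v → half S v u)) ⟩
    ∑∑ (half S) + ∑∑ (half S)                 ∎
    where open ≡-Reasoning

  -- frac q a = a / n !
  q : ℕ
  q = pred (n !)

  suc-q : suc q ≡ n !
  suc-q = suc-pred (n !) {{n !≢0}}

  lookup-false : ∀ {S : Subset n} {u} → lookup S u ≡ false → u ∉ S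
  lookup-false eq u∈S = contradiction (trans (sym eq) ([]=⇒lookup u∈S)) λ ()

  invDist-kept : ∀ S {u v} → u ≢ v → u ∉ S → invDist (dist G S u v) ≡ frac q (kept S u v)
  invDist-kept S {u} {v} u≢v u∉S with avoids? S u v
  ... | no ¬av rewrite dist-blocked u∉S ¬av = sym (frac-0 q)
  ... | yes av rewrite dist-avoids av | *-identityˡ (ω n (d u v)) = inverse (d u v) refl
    where
    inverse : ∀ k → d u v ≡ k → invDist (just k) ≡ frac q (ω n k)
    inverse zero    eq = contradiction (d-zero eq) u≢v
    inverse (suc m) eq = frac-inverse q m
      (trans (cong (λ k → k * ω n k) (sym eq)) (trans (*-ωd u≢v) (sym suc-q)))

  kept-∈ : ∀ S {u v} → lookup S u ∨ lookup S v ≡ true → kept S u v ≡ 0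
  kept-∈ S {u} {v} p = cong (_* ω n (d u v)) (χ-no (avoids? S u v) (blocked (∨-true (lookup S u) p)))
    where
    blocked : lookup S u ≡ true ⊎ lookup S v ≡ true → ¬ Avoids S u v
    blocked (inj₁ u∈) av = av u (lookup⇒[]= u S u∈) (on-left u v)
    blocked (inj₂ v∈) av = av v (lookup⇒[]= v S v∈) (on-right u v)

  IGL-term : ∀ S u v →
    (if lookup S u ∨ lookup S v then 0ℚ
     else (if toℕ u <ᵇ toℕ v then invDist (dist G S u v) else 0ℚ)) ≡ frac q (half S u v)
  IGL-term S u v with lookup S u ∨ lookup S v in blocked | toℕ u <ᵇ toℕ v in lt
  ... | true  | true  = sym (trans (cong (frac q) (kept-∈ S blocked)) (frac-0 q))
  ... | true  | false = sym (frac-0 q)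
  ... | false | false = sym (frac-0 q)
  ... | false | true  = invDist-kept S u≢v (lookup-false (∨-conicalˡ _ _ blocked))
    where
    u≢v : u ≢ v
    u≢v refl = <-irrefl refl (<ᵇ⇒< (toℕ u) (toℕ u) (subst Bool.T (sym lt) _))

  IGLdel-half : ∀ S → IGLdel G S ≡ frac q (∑∑ (half S))
  IGLdel-half S = sumFin-frac q λ u → sumFin-frac q λ v → IGL-term S u v

  IGL-energy : ∀ S S′ → IGLdel G S ℚ.≤ IGLdel G S′ → energy S ≤ energy S′
  IGL-energy S S′ le = subst₂ _≤_ (sym (energy-half S)) (sym (energy-half S′)) (+-mono-≤ half≤ half≤)
    where
    half≤ : ∑∑ (half S) ≤ ∑∑ (half S′)
    half≤ = frac-cancel-≤ q (subst₂ ℚ._≤_ (IGLdel-half S) (IGLdel-half S′) le)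

  -- A walk found by `within` starts at v ∉ S, so `walk-avoids` applies to it.
  componentSize≤component : ∀ S v → v ∉ S → componentSize G S v ≤ component S v
  componentSize≤component S v v∉S = subst (_≤ component S v) (sym (∣p∣≡sum (tabulate f)))
    (sum-mono λ w → χ-mono (w ∈? tabulate f) (avoids? S v w) λ w∈ →
      let p = trans (sym (lookup∘tabulate f w)) ([]=⇒lookup w∈)
          _ , _ , walk = within-walk n (∧-conicalʳ (not (lookup S w)) _ p)
      in walk-avoids v∉S walk)
    where
    f : Fin n → Bool
    f w = not (lookup S w) ∧ within G S n v w

  bound : ∀ S → 1 ≤ ∣ S ∣ → (∀ S′ → ∣ S′ ∣ ≡ ∣ S ∣ → IGLdel G S ℚ.≤ IGLdel G S′) →
          ∀ v → v ∉ S → componentSize G S v * ∣ S ∣ ^ 5 ≤ 6 * n ^ 5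
  bound S 1≤k minimal v v∉S = ≤-trans (*-monoˡ-≤ (∣ S ∣ ^ 5) (componentSize≤component S v v∉S))
    (component-bound S 1≤k (λ S′ eq → IGL-energy S S′ (minimal S′ eq)) v)

theorem21 : Σ ℕ λ c → (0 < c) ×
    (∀ (n : ℕ) (T : Graph n) → IsTree T →
    ∀ (k : ℕ) (S : Subset n) → ∣ S ∣ ≡ k → 1 ≤ k →
    (∀ (S′ : Subset n) → ∣ S′ ∣ ≡ k → IGLdel T S Data.Rational.≤ IGLdel T S′) →
    ∀ (v : Fin n) → v ∉ S →
    componentSize T S v * k ^ 5 ≤ c * n ^ 5)
theorem21 = 6 , s≤s z≤n , λ { n T (connected , acyclic) _ S refl → Minimizer.bound T connected acyclic S }
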